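{- Let $G$ and $G'$ be graphs on the vertex set $\{1,\dots,n\}$ with adjacency matrices $\Gamma$ and $\Gamma'$ (over $\mathbb{F}_2$), respectively. Then $G$ and $G'$ are edge-locally equivalent if and only if there exists $H\in\mathcal{H}_n$ such that $\Gamma\in\Delta(H)$ and $H(\Gamma)=\Gamma'$.
   Context: All matrices are over $\mathbb{F}_2$. Graphs are finite, undirected and simple with vertex set $V=\{1,\dots,n\}$; an adjacency matrix is a symmetric matrix over $\mathbb{F}_2$ with zero diagonal. Local complementation: for a vertex $i$, $G*i$ is the graph on $V$ obtained from $G$ by replacing the subgraph induced on the neighborhood $N(i)$ by its complement and leaving the rest unchanged. For an edge $e=\{i,j\}$ of $G$, the edge-local complement is $G*e=((G*i)*j)*i=((G*j)*i)*j$. Two graphs $G,G'$ on $V$ are edge-locally equivalent if there is a finite (possibly empty) sequence $e_1,\dots,e_N$ of 2-element subsets of $V$ such that $e_1$ is an edge of $G$, $e_\alpha$ is an edge of $((G*e_1)*\dots)*e_{\alpha-1}$ for $\alpha=2,\dots,N$, and $((G*e_1)*\dots)*e_N=G'$. Linear fractional transformations: $\mathcal{C}_n$ is the group of all nonsingular $2n\times 2n$ matrices $Q=\left[\begin{array}{cc}A&B\\C&D\end{array}\right]$, written $Q=[A,B,C,D]$, with $A,B,C,D$ diagonal $n\times n$ matrices (equivalently $AD+BC=I$). When $C\Gamma+D$ is nonsingular, $Q(\Gamma)=(A\Gamma+B)(C\Gamma+D)^{ -1}$. The domain $\Delta(Q)$ is the set of all $n\times n$ adjacency matrices $\Gamma$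 such that $C\Gamma+D$ is nonsingular and $Q(\Gamma)$ has zero diagonal. $\mathcal{H}_n\subseteq\mathcal{C}_n$ is the subgroup of all $H^A:=[A+I,A,A,A+I]$ with $A$ a diagonal $n\times n$ matrix. -}

module Defs where

open import Algebra.Bundles using (CommutativeRing)
open import Algebra.Definitions using (Invertible)
open import Data.Bool.Base using (Bool; true; false; not; _∧_; if_then_else_)
open import Data.Bool.Properties using (xor-∧-commutativeRing; ∧-comm)
open import Data.Fin.Base using (Fin; zero; suc; _<_; splitAt; _↑ˡ_; _↑ʳ_)
open import Data.Fin.Properties using (_≟_; splitAt-↑ˡ; splitAt-↑ʳ; splitAt⁻¹-↑ˡ; splitAt⁻¹-↑ʳ)
open import Data.List.Base using (List; []; _∷_; foldl)
open import Data.Nat.Base using (ℕ; zero; suc) renaming (_+_ to _+ℕ_)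
open import Data.Product.Base using (_×_; _,_; Σ-syntax; ∃-syntax; proj₁)
open import Data.Sum.Base using (_⊎_; inj₁; inj₂)
open import Data.Sum.Properties using (inj₁-injective; inj₂-injective)
open import Data.Unit.Base using (⊤)
open import Data.Vec.Functional using (Vector)
open import Relation.Binary.PropositionalEquality
  using (_≡_; refl; sym; trans; cong; cong₂)
open import Relation.Nullary.Decidable using (does; yes; no)
open import Relation.Nullary.Negation using (contradiction)

-- The field 𝔽₂ is Bool with xor as addition and ∧ as multiplication.
open CommutativeRing xor-∧-commutativeRing public
  using (_+_; _*_; 0#; 1#; semiring; +-assoc; +-identityʳ)
  renaming (Carrier to 𝔽₂)
open import Algebra.Properties.Semiring.Sum semiring public
  using (sum; sum-syntax; sum-cong-≗; sum-replicate-zero)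

private
  variable
    n : ℕ

Matrix : ℕ → Set
Matrix n = Fin n → Fin n → 𝔽₂

infix 4 _≈ᴹ_
_≈ᴹ_ : Matrix n → Matrix n → Set
M ≈ᴹ N = ∀ i j → M i j ≡ N i j

infixl 6 _⊕_
_⊕_ : Matrix n → Matrix n → Matrix n
(M ⊕ N) i j = M i j + N i j

infixl 7 _⊗_
_⊗_ : Matrix n → Matrix n → Matrix n
_⊗_ {n} M N i j = ∑[ k < n ] (M i k * N k j)

-- A diagonal matrix is given by its vector of diagonal entries.
DiagonalMatrix : ℕ → Set
DiagonalMatrix n = Vector 𝔽₂ n

diag : DiagonalMatrix n → Matrix n
diag a i j = if does (i ≟ j) then a i else 0#

1ᴰ : DiagonalMatrix n
1ᴰ _ = 1#

infixl 6 _+ᴰ_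
_+ᴰ_ : DiagonalMatrix n → DiagonalMatrix n → DiagonalMatrix n
(a +ᴰ b) i = a i + b i

1ᴹ : Matrix n
1ᴹ = diag 1ᴰ

Nonsingular : Matrix n → Set
Nonsingular = Invertible _≈ᴹ_ 1ᴹ _⊗_

inverse : (M : Matrix n) → Nonsingular M → Matrix n
inverse _ = proj₁

ZeroDiagonal : Matrix n → Set
ZeroDiagonal M = ∀ i → M i i ≡ 0#

record IsAdjacencyMatrix (M : Matrix n) : Set where
  field
    symmetric    : ∀ i j → M i j ≡ M j i
    zeroDiagonal : ZeroDiagonal M

record Graph (n : ℕ) : Set where
  field
    edge   : Fin n → Fin n → Bool
    symm   : ∀ i j → edge i j ≡ edge j i
    irrefl : ∀ i → edge i i ≡ false

open Graph public

adjacencyMatrix : Graph n → Matrix n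
adjacencyMatrix G i j = edge G i j

infix 4 _≈ᴳ_
_≈ᴳ_ : Graph n → Graph n → Set
G ≈ᴳ G′ = ∀ i j → edge G i j ≡ edge G′ i j

private
  does-sym : (i j : Fin n) → does (i ≟ j) ≡ does (j ≟ i)
  does-sym i j with i ≟ j | j ≟ i
  ... | yes _ | yes _ = refl
  ... | no _  | no _  = refl
  ... | yes p | no ¬q = contradiction (sym p) ¬q
  ... | no ¬p | yes q = contradiction (sym q) ¬p

  does-refl : (i : Fin n) → does (i ≟ i) ≡ true
  does-refl i with i ≟ i
  ... | yes _ = refl
  ... | no ¬p = contradiction refl ¬p

complement : Graph n → Graph n
complement G .edge u v = not (does (u ≟ v)) ∧ not (edge G u v)
complement G .symm u v rewrite does-sym u v | symm G u v = refl
complement G .irrefl u rewrite does-refl u = refl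

infixl 8 _⋆_ _⋆ᵉ_

-- Local complementation at a vertex; u and v both lie in N(i) iff
-- edge G i u ∧ edge G i v.
_⋆_ : Graph n → Fin n → Graph n
(G ⋆ i) .edge u v =
  if edge G i u ∧ edge G i v then edge (complement G) u v else edge G u v
(G ⋆ i) .symm u v
  rewrite ∧-comm (edge G i u) (edge G i v) | symm (complement G) u v | symm G u v = refl
(G ⋆ i) .irrefl u with edge G i u ∧ edge G i u
... | true  = irrefl (complement G) u
... | false = irrefl G u

-- A 2-element subset {lo , hi} of the vertex set, listed in increasing order.
record Pair (n : ℕ) : Set where
  field
    lo hi : Fin n
    lo<hi : lo < hi

open Pair public

_IsEdgeOf_ : Pair n → Graph n → Set
e IsEdgeOf G = edge G (lo e) (hi e) ≡ true

-- Edge-local complementation, used only when e is an edge of G; in that case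
-- G ⋆ i ⋆ j ⋆ i and G ⋆ j ⋆ i ⋆ j coincide, so the order of the endpoints
-- is immaterial.
_⋆ᵉ_ : Graph n → Pair n → Graph n
G ⋆ᵉ e = G ⋆ lo e ⋆ hi e ⋆ lo e

Admissible : Graph n → List (Pair n) → Set
Admissible G []       = ⊤
Admissible G (e ∷ es) = e IsEdgeOf G × Admissible (G ⋆ᵉ e) es

EdgeLocallyEquivalent : Graph n → Graph n → Set
EdgeLocallyEquivalent G G′ = ∃[ es ] (Admissible G es × foldl _⋆ᵉ_ G es ≈ᴳ G′)

blockEntry : (A B C D : Matrix n) → Fin n ⊎ Fin n → Fin n ⊎ Fin n → 𝔽₂
blockEntry A B C D (inj₁ i) (inj₁ j) = A i j
blockEntry A B C D (inj₁ i) (inj₂ j) = B i j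
blockEntry A B C D (inj₂ i) (inj₁ j) = C i j
blockEntry A B C D (inj₂ i) (inj₂ j) = D i j

-- The 2n × 2n matrix with top row of blocks A, B and bottom row C, D.
block : (A B C D : Matrix n) → Matrix (n +ℕ n)
block {n} A B C D i j = blockEntry A B C D (splitAt n i) (splitAt n j)

diagBlock : (A B C D : DiagonalMatrix n) → Matrix (n +ℕ n)
diagBlock A B C D = block (diag A) (diag B) (diag C) (diag D)

record 𝒞 (n : ℕ) : Set where
  field
    A B C D     : DiagonalMatrix n
    nonsingular : Nonsingular (diagBlock A B C D)

  toMatrix : Matrix (n +ℕ n)
  toMatrix = diagBlock A B C D

open 𝒞 public using (toMatrix)

denominator : 𝒞 n → Matrix n → Matrix n
denominator Q Γ = diag C ⊗ Γ ⊕ diag D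
  where open 𝒞 Q

transform : (Q : 𝒞 n) (Γ : Matrix n) → Nonsingular (denominator Q Γ) → Matrix n
transform Q Γ ns = (diag A ⊗ Γ ⊕ diag B) ⊗ inverse (denominator Q Γ) ns
  where open 𝒞 Q

infix 4 _∈Δ_
record _∈Δ_ (Γ : Matrix n) (Q : 𝒞 n) : Set where
  field
    isAdjacencyMatrix : IsAdjacencyMatrix Γ
    nonsingular       : Nonsingular (denominator Q Γ)
    zeroDiagonal      : ZeroDiagonal (transform Q Γ nonsingular)

image : (Q : 𝒞 n) {Γ : Matrix n} → Γ ∈Δ Q → Matrix n
image Q {Γ} Γ∈Δ = transform Q Γ (_∈Δ_.nonsingular Γ∈Δ)

diag-⊗ : (a : DiagonalMatrix n) (M : Matrix n) (i j : Fin n) →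
         (diag a ⊗ M) i j ≡ a i * M i j
diag-⊗ a M i j = sum-diag a i (λ k → M k j)
  where
  sum-diag : ∀ {n} (a : DiagonalMatrix n) i (t : Vector 𝔽₂ n) →
             ∑[ k < n ] (diag a i k * t k) ≡ a i * t i
  sum-diag {suc n} a zero    t =
    trans (cong (a zero * t zero +_) (sum-replicate-zero n)) (+-identityʳ _)
  sum-diag {suc n} a (suc i) t = sum-diag (λ k → a (suc k)) i (λ k → t (suc k))

block-⊗ : (A B C D A′ B′ C′ D′ : Matrix n) →
          block A B C D ⊗ block A′ B′ C′ D′
            ≈ᴹ block (A ⊗ A′ ⊕ B ⊗ C′) (A ⊗ B′ ⊕ B ⊗ D′)
                     (C ⊗ A′ ⊕ D ⊗ C′) (C ⊗ B′ ⊕ D ⊗ D′)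
block-⊗ {n} A B C D A′ B′ C′ D′ i j =
  trans (sum-↑ n (λ k → P (splitAt n i) (splitAt n k) * Q (splitAt n k) (splitAt n j)))
    (trans (cong₂ _+_
        (sum-cong-≗ (λ k → cong (λ s → P (splitAt n i) s * Q s (splitAt n j)) (splitAt-↑ˡ n k n)))
        (sum-cong-≗ (λ k → cong (λ s → P (splitAt n i) s * Q s (splitAt n j)) (splitAt-↑ʳ n n k))))
      (merge (splitAt n i) (splitAt n j)))
  where
  P Q : Fin n ⊎ Fin n → Fin n ⊎ Fin n → 𝔽₂
  P = blockEntry A B C D
  Q = blockEntry A′ B′ C′ D′

  sum-↑ : ∀ m {n} (t : Vector 𝔽₂ (m +ℕ n)) →
          sum t ≡ ∑[ k < m ] t (k ↑ˡ n) + ∑[ k < n ] t (m ↑ʳ k)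
  sum-↑ zero    t = refl
  sum-↑ (suc m) t =
    trans (cong (t zero +_) (sum-↑ m (λ k → t (suc k)))) (sym (+-assoc (t zero) _ _))

  merge : ∀ s t →
    ∑[ k < n ] (P s (inj₁ k) * Q (inj₁ k) t) + ∑[ k < n ] (P s (inj₂ k) * Q (inj₂ k) t)
      ≡ blockEntry (A ⊗ A′ ⊕ B ⊗ C′) (A ⊗ B′ ⊕ B ⊗ D′)
                   (C ⊗ A′ ⊕ D ⊗ C′) (C ⊗ B′ ⊕ D ⊗ D′) s t
  merge (inj₁ _) (inj₁ _) = refl
  merge (inj₁ _) (inj₂ _) = refl
  merge (inj₂ _) (inj₁ _) = refl
  merge (inj₂ _) (inj₂ _) = refl

0ᴹ : Matrix n
0ᴹ _ _ = 0#

1ᴹ-block : 1ᴹ ≈ᴹ block {n} 1ᴹ 0ᴹ 0ᴹ 1ᴹ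
1ᴹ-block {n} i j with splitAt n i in p | splitAt n j in q
... | inj₁ i′ | inj₁ j′ with i′ ≟ j′ | i ≟ j
...   | yes _    | yes _    = refl
...   | no _     | no _     = refl
...   | yes refl | no i≢j   = contradiction (trans (sym (splitAt⁻¹-↑ˡ p)) (splitAt⁻¹-↑ˡ q)) i≢j
...   | no i′≢j′ | yes refl = contradiction (inj₁-injective (trans (sym p) q)) i′≢j′
1ᴹ-block {n} i j | inj₂ i′ | inj₂ j′ with i′ ≟ j′ | i ≟ j
...   | yes _    | yes _    = refl
...   | no _     | no _     = refl
...   | yes refl | no i≢j   = contradiction (trans (sym (splitAt⁻¹-↑ʳ p)) (splitAt⁻¹-↑ʳ q)) i≢j
...   | no i′≢j′ | yes refl = contradiction (inj₂-injective (trans (sym p) q)) i′≢j′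
1ᴹ-block {n} i j | inj₁ i′ | inj₂ j′ with i ≟ j
...   | no _     = refl
...   | yes refl = contradiction (trans (sym p) q) λ ()
1ᴹ-block {n} i j | inj₂ i′ | inj₁ j′ with i ≟ j
...   | no _     = refl
...   | yes refl = contradiction (trans (sym p) q) λ ()

-- (A + I)² + A² = I  and  (A + I) A + A (A + I) = 0  over 𝔽₂.
H-involutive : (A : DiagonalMatrix n) →
               let M = diagBlock (A +ᴰ 1ᴰ) A A (A +ᴰ 1ᴰ) in M ⊗ M ≈ᴹ 1ᴹ
H-involutive {n} A i j =
  trans (block-⊗ A+I (diag A) (diag A) A+I A+I (diag A) (diag A) A+I i j)
    (trans (entries (splitAt n i) (splitAt n j)) (sym (1ᴹ-block {n} i j)))
  where
  A+I : Matrix n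
  A+I = diag (A +ᴰ 1ᴰ)

  products : (p q : DiagonalMatrix n) (R S : Matrix n) (i j : Fin n) →
    (diag p ⊗ R ⊕ diag q ⊗ S) i j ≡ p i * R i j + q i * S i j
  products p q R S i j = cong₂ _+_ (diag-⊗ p R i j) (diag-⊗ q S i j)

  entry₁₁ : ∀ x e → (x + 1#) * (if e then x + 1# else 0#) + x * (if e then x else 0#)
                      ≡ (if e then 1# else 0#)
  entry₁₁ true  true  = refl
  entry₁₁ true  false = refl
  entry₁₁ false true  = refl
  entry₁₁ false false = refl

  entry₁₂ : ∀ x e → (x + 1#) * (if e then x else 0#) + x * (if e then x + 1# else 0#) ≡ 0#
  entry₁₂ true  true  = refl
  entry₁₂ true  false = refl
  entry₁₂ false true  = refl
  entry₁₂ false false = refl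

  entry₂₁ : ∀ x e → x * (if e then x + 1# else 0#) + (x + 1#) * (if e then x else 0#) ≡ 0#
  entry₂₁ true  true  = refl
  entry₂₁ true  false = refl
  entry₂₁ false true  = refl
  entry₂₁ false false = refl

  entry₂₂ : ∀ x e → x * (if e then x else 0#) + (x + 1#) * (if e then x + 1# else 0#)
                      ≡ (if e then 1# else 0#)
  entry₂₂ true  true  = refl
  entry₂₂ true  false = refl
  entry₂₂ false true  = refl
  entry₂₂ false false = refl

  entries : ∀ s t →
    blockEntry (A+I ⊗ A+I ⊕ diag A ⊗ diag A) (A+I ⊗ diag A ⊕ diag A ⊗ A+I)
               (diag A ⊗ A+I ⊕ A+I ⊗ diag A) (diag A ⊗ diag A ⊕ A+I ⊗ A+I) s t
      ≡ blockEntry 1ᴹ 0ᴹ 0ᴹ 1ᴹ s t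
  entries (inj₁ i) (inj₁ j) =
    trans (products (A +ᴰ 1ᴰ) A A+I (diag A) i j) (entry₁₁ (A i) (does (i ≟ j)))
  entries (inj₁ i) (inj₂ j) =
    trans (products (A +ᴰ 1ᴰ) A (diag A) A+I i j) (entry₁₂ (A i) (does (i ≟ j)))
  entries (inj₂ i) (inj₁ j) =
    trans (products A (A +ᴰ 1ᴰ) A+I (diag A) i j) (entry₂₁ (A i) (does (i ≟ j)))
  entries (inj₂ i) (inj₂ j) =
    trans (products A (A +ᴰ 1ᴰ) (diag A) A+I i j) (entry₂₂ (A i) (does (i ≟ j)))

-- Hᴬ = [A + I, A, A, A + I], which is its own inverse.
H^ : DiagonalMatrix n → 𝒞 n
H^ A .𝒞.A = A +ᴰ 1ᴰ
H^ A .𝒞.B = A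
H^ A .𝒞.C = A
H^ A .𝒞.D = A +ᴰ 1ᴰ
H^ A .𝒞.nonsingular =
  diagBlock (A +ᴰ 1ᴰ) A A (A +ᴰ 1ᴰ) , H-involutive A , H-involutive A

infix 4 _∈ℋ
_∈ℋ : 𝒞 n → Set
_∈ℋ {n} Q = Σ[ A ∈ DiagonalMatrix n ] toMatrix Q ≈ᴹ toMatrix (H^ A)

{-# OPTIONS --safe #-}
module Submission where

-- Hᴬ(Γ) = Γ′ says that exchanging the coordinates in A between x and y carries
-- the linear space {(x , y) | y = Γ x} onto the one of Γ′; such exchanges
-- compose by adding index sets. With α = (row i of Γ) + eᵢ and
-- β = (row j of Γ) + eⱼ, the edge-local complement at {i , j} is
-- Γ + α βᵀ + β αᵀ, which is the exchange on {i , j}. Conversely, if Γ can be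
-- exchanged on S ≠ ∅ and i ∈ S, then i has a neighbour j in S: otherwise the
-- pair (eᵢ , Γ eᵢ) would be sent to (0 , y) with y ≠ 0. Pivoting on {i , j}
-- leaves an exchange on the smaller set S ∖ {i , j}.

open import Defs
open import Algebra.Bundles using (CommutativeRing)
open import Data.Bool.Base using (true; false; not; _∧_; if_then_else_)
open import Data.Bool.Properties using (xor-∧-commutativeRing) renaming (_≟_ to _≟ᵇ_)
open import Data.Bool.Solver using (module xor-∧-Solver)
open import Data.Fin.Base using (Fin; _↑ˡ_; _↑ʳ_)
open import Data.Fin.Properties using (_≟_; any?; <-cmp; splitAt-↑ˡ; splitAt-↑ʳ)
open import Data.List.Base using (List; []; _∷_; allFin)
open import Data.List.Membership.Propositional using (_∈_)
open import Data.List.Membership.Propositional.Properties using (∈-allFin)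
open import Data.List.Relation.Unary.Any using (tail)
open import Data.Nat.Base using (ℕ)
open import Data.Product.Base using (_×_; _,_; Σ-syntax; ∃-syntax)
open import Data.Vec.Functional using (Vector)
open import Function.Base using (_∘_)
open import Function.Bundles using (_⇔_; mk⇔)
open import Relation.Binary.Definitions using (tri<; tri≈; tri>)
open import Relation.Binary.PropositionalEquality
  using (_≡_; _≢_; _≗_; refl; sym; trans; cong; cong₂; module ≡-Reasoning)
open import Relation.Nullary.Decidable using (Dec; yes; no; dec-true; dec-false)
open import Relation.Nullary.Negation using (contradiction)

open CommutativeRing xor-∧-commutativeRing
  using (+-comm; *-assoc; *-comm; distribʳ; zeroʳ)
open import Algebra.Properties.Semiring.Sum semiring
  using (∑-distrib-+; ∑-comm; *-distribˡ-sum; *-distribʳ-sum)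
open xor-∧-Solver using (solve; con; _:+_; _:*_; _:=_)
open ≡-Reasoning

private
  variable
    n : ℕ

-- Pairing of vectors and the action of matrices.

1ᴹ-diagonal : (i : Fin n) → 1ᴹ i i ≡ 1#
1ᴹ-diagonal i rewrite dec-true (i ≟ i) refl = refl

1ᴹ-off-diagonal : {i j : Fin n} → i ≢ j → 1ᴹ i j ≡ 0#
1ᴹ-off-diagonal {i = i} {j} i≢j rewrite dec-false (i ≟ j) i≢j = refl

⟨_,_⟩ : Vector 𝔽₂ n → Vector 𝔽₂ n → 𝔽₂
⟨_,_⟩ {n} a x = ∑[ k < n ] (a k * x k)

infixr 7 _·_
_·_ : Matrix n → Vector 𝔽₂ n → Vector 𝔽₂ n
(M · x) i = ⟨ M i , x ⟩

infixl 6 _+ⱽ_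
_+ⱽ_ : Vector 𝔽₂ n → Vector 𝔽₂ n → Vector 𝔽₂ n
(x +ⱽ y) i = x i + y i

infixr 7 _*ⱽ_
_*ⱽ_ : 𝔽₂ → Vector 𝔽₂ n → Vector 𝔽₂ n
(s *ⱽ x) i = s * x i

⟨,⟩-cong : {a b x y : Vector 𝔽₂ n} → a ≗ b → x ≗ y → ⟨ a , x ⟩ ≡ ⟨ b , y ⟩
⟨,⟩-cong p q = sum-cong-≗ λ k → cong₂ _*_ (p k) (q k)

⟨,⟩-congˡ : (a : Vector 𝔽₂ n) {x y : Vector 𝔽₂ n} → x ≗ y → ⟨ a , x ⟩ ≡ ⟨ a , y ⟩
⟨,⟩-congˡ a = ⟨,⟩-cong {a = a} (λ _ → refl)

⟨,⟩-comm : (a x : Vector 𝔽₂ n) → ⟨ a , x ⟩ ≡ ⟨ x , a ⟩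
⟨,⟩-comm a x = sum-cong-≗ λ k → *-comm (a k) (x k)

⟨,⟩-+ˡ : (a b x : Vector 𝔽₂ n) → ⟨ a +ⱽ b , x ⟩ ≡ ⟨ a , x ⟩ + ⟨ b , x ⟩
⟨,⟩-+ˡ a b x = trans
  (sum-cong-≗ λ k → distribʳ (x k) (a k) (b k))
  (∑-distrib-+ (λ k → a k * x k) (λ k → b k * x k))

⟨,⟩-*ˡ : (s : 𝔽₂) (a x : Vector 𝔽₂ n) → ⟨ s *ⱽ a , x ⟩ ≡ s * ⟨ a , x ⟩
⟨,⟩-*ˡ s a x = trans
  (sum-cong-≗ λ k → *-assoc s (a k) (x k))
  (sym (*-distribˡ-sum s (λ k → a k * x k)))

⟨,⟩-1ᴹˡ : (i : Fin n) (x : Vector 𝔽₂ n) → ⟨ 1ᴹ i , x ⟩ ≡ x i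
-- The vector `x` is read as a matrix all of whose columns are `x`; the second index `i` is a dummy.
⟨,⟩-1ᴹˡ i x = diag-⊗ 1ᴰ (λ k _ → x k) i i

⟨,⟩-zeroʳ : (a : Vector 𝔽₂ n) {x : Vector 𝔽₂ n} → (∀ k → x k ≡ 0#) → ⟨ a , x ⟩ ≡ 0#
⟨,⟩-zeroʳ {n} a x≡0 = trans
  (sum-cong-≗ λ k → trans (cong (a k *_) (x≡0 k)) (zeroʳ (a k)))
  (sum-replicate-zero n)

⊗-· : (M N : Matrix n) (x : Vector 𝔽₂ n) → (M ⊗ N) · x ≗ M · N · x
⊗-· {n} M N x i = begin
  ∑[ k < n ] ((M ⊗ N) i k * x k)
    ≡⟨ sum-cong-≗ (λ k → *-distribʳ-sum (x k) (λ l → M i l * N l k)) ⟩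
  ∑[ k < n ] ∑[ l < n ] (M i l * N l k * x k)
    ≡⟨ ∑-comm (λ k l → M i l * N l k * x k) ⟩
  ∑[ l < n ] ∑[ k < n ] (M i l * N l k * x k)
    ≡⟨ sum-cong-≗ (λ l → trans (sum-cong-≗ λ k → *-assoc (M i l) (N l k) (x k))
                                (sym (*-distribˡ-sum (M i l) (λ k → N l k * x k)))) ⟩
  (M · N · x) i ∎

-- Row `j` of `1ᴹ` is the `j`-th unit vector and picks out column `j`. Matrix identities below are
-- thereby proved by following a single vector.
·-injective : {M N : Matrix n} → (∀ x → M · x ≗ N · x) → M ≈ᴹ N
·-injective {M = M} {N} eq i j =
  trans (sym (column M)) (trans (eq (1ᴹ j) i) (column N))
  where
  column : ∀ M → (M · 1ᴹ j) i ≡ M i j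
  column M = trans (⟨,⟩-comm (M i) (1ᴹ j)) (⟨,⟩-1ᴹˡ j (M i))

affine-· : (a b : DiagonalMatrix n) (M : Matrix n) (x : Vector 𝔽₂ n) (i : Fin n) →
           ((diag a ⊗ M ⊕ diag b) · x) i ≡ a i * (M · x) i + b i * x i
affine-· a b M x i = begin
  ⟨ (diag a ⊗ M) i +ⱽ diag b i , x ⟩
    ≡⟨ ⟨,⟩-+ˡ ((diag a ⊗ M) i) (diag b i) x ⟩
  ((diag a ⊗ M) · x) i + ⟨ diag b i , x ⟩
    ≡⟨ cong₂ _+_ (trans (⊗-· (diag a) M x i) (diag-⊗ a (λ k _ → (M · x) k) i i))
                 (diag-⊗ b (λ k _ → x k) i i) ⟩
  a i * (M · x) i + b i * x i ∎

-- Exchanging coordinates between argument and value.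

-- First component of the exchanged pair: `y i` where `S i` is 1, else `x i`. The second component
-- is `exchange S y x`.
exchange : DiagonalMatrix n → Vector 𝔽₂ n → Vector 𝔽₂ n → Vector 𝔽₂ n
exchange S x y i = S i * y i + (S i + 1#) * x i

-- Exchanging the coordinates in S between argument and value maps the graph
-- of M into the graph of N.
record Exchanges (S : DiagonalMatrix n) (M N : Matrix n) : Set where
  constructor exchanges
  field
    value : ∀ x → N · exchange S x (M · x) ≗ exchange S (M · x) x

open Exchanges

exchange-congˡ : (S : DiagonalMatrix n) {x x′ : Vector 𝔽₂ n} (y : Vector 𝔽₂ n) →
                 x ≗ x′ → exchange S x y ≗ exchange S x′ y
exchange-congˡ S y p i = cong (λ u → S i * y i + (S i + 1#) * u) (p i)

exchange-congʳ : (S : DiagonalMatrix n) (x : Vector 𝔽₂ n) {y y′ : Vector 𝔽₂ n} →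
                 y ≗ y′ → exchange S x y ≗ exchange S x y′
exchange-congʳ S x p i = cong (λ v → S i * v + (S i + 1#) * x i) (p i)

-- A coordinate in both `S` and `T` is swapped twice and returns, so the symmetric difference
-- remains, which is the sum over 𝔽₂.
exchange-exchange : (S T : DiagonalMatrix n) (x y : Vector 𝔽₂ n) →
  exchange T (exchange S x y) (exchange S y x) ≗ exchange (S +ᴰ T) x y
exchange-exchange S T x y i = bits (S i) (T i) (x i) (y i)
  where
  bits : ∀ s t x y → t * (s * x + (s + 1#) * y) + (t + 1#) * (s * y + (s + 1#) * x)
                     ≡ (s + t) * y + (s + t + 1#) * x
  bits false false x y = refl
  bits false true  x y = refl
  bits true  false x y = solve 2 (λ x y → (y :+ con false) := (y :+ con false)) refl x y
  bits true  true  x y = solve 2 (λ x y → ((x :+ con false) :+ con false) := x) refl x y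

exchange-involutive : (S : DiagonalMatrix n) (x y : Vector 𝔽₂ n) →
  exchange S (exchange S x y) (exchange S y x) ≗ x
exchange-involutive S x y i = bits (S i) (x i) (y i)
  where
  bits : ∀ s x y → s * (s * x + (s + 1#) * y) + (s + 1#) * (s * y + (s + 1#) * x) ≡ x
  bits false x y = refl
  bits true  x y = solve 1 (λ x → ((x :+ con false) :+ con false) := x) refl x

-- The first exchange sends `(x , M · x)` to `(x′ , N · x′)`, so the second hypothesis applies at
-- `x′`.
Exchanges-trans : {S T : DiagonalMatrix n} {M N P : Matrix n} →
                  Exchanges S M N → Exchanges T N P → Exchanges (S +ᴰ T) M P
Exchanges-trans {S = S} {T} {M} {N} {P} (exchanges MN) (exchanges NP) .value x i = begin
  (P · exchange (S +ᴰ T) x y) i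
    ≡⟨ ⟨,⟩-congˡ (P i) (λ k → trans (sym (exchange-exchange S T x y k))
                                      (exchange-congʳ T x′ (sym ∘ MN x) k)) ⟩
  (P · exchange T x′ (N · x′)) i
    ≡⟨ NP x′ i ⟩
  exchange T (N · x′) x′ i
    ≡⟨ exchange-congˡ T x′ (MN x) i ⟩
  exchange T (exchange S y x) x′ i
    ≡⟨ exchange-exchange S T y x i ⟩
  exchange (S +ᴰ T) y x i ∎
  where
  y  = M · x
  x′ = exchange S x y

Exchanges-reindex : {S T : DiagonalMatrix n} {M N : Matrix n} →
                    S ≗ T → Exchanges S M N → Exchanges T M N
Exchanges-reindex {S = S} {T} {M} {N} S≗T (exchanges MN) .value x i = begin
  (N · exchange T x (M · x)) i ≡⟨ ⟨,⟩-congˡ (N i) (λ k → sym (eq x (M · x) k)) ⟩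
  (N · exchange S x (M · x)) i ≡⟨ MN x i ⟩
  exchange S (M · x) x i       ≡⟨ eq (M · x) x i ⟩
  exchange T (M · x) x i       ∎
  where
  eq : ∀ x y → exchange S x y ≗ exchange T x y
  eq x y i = cong (λ s → s * y i + (s + 1#) * x i) (S≗T i)

-- At `S = 0` each `exchange` computes to its first vector, leaving `N · x ≗ M · x`.
Exchanges-0 : {M N : Matrix n} → M ≈ᴹ N → Exchanges (λ _ → 0#) M N
Exchanges-0 M≈N .value x i = ⟨,⟩-cong (λ k → sym (M≈N i k)) (λ _ → refl)

Exchanges-0⁻¹ : {M N : Matrix n} → Exchanges (λ _ → 0#) M N → M ≈ᴹ N
Exchanges-0⁻¹ (exchanges MN) = ·-injective λ x i → sym (MN x i)

-- Exchanges as linear fractional transformations.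

denominator-· : (S : DiagonalMatrix n) (M : Matrix n) (x : Vector 𝔽₂ n) →
                denominator (H^ S) M · x ≗ exchange S x (M · x)
denominator-· S M x i = affine-· S (S +ᴰ 1ᴰ) M x i

numerator : 𝒞 n → Matrix n → Matrix n
numerator Q Γ = diag A ⊗ Γ ⊕ diag B
  where open 𝒞 Q

numerator-· : (S : DiagonalMatrix n) (M : Matrix n) (x : Vector 𝔽₂ n) →
              numerator (H^ S) M · x ≗ exchange S (M · x) x
numerator-· S M x i = trans (affine-· (S +ᴰ 1ᴰ) S M x i)
  (+-comm ((S i + 1#) * (M · x) i) (S i * x i))

-- The denominator of `M` yields the first component of the exchanged pair and `N` maps it to the
-- second; exchanging once more restores `x`.
denominator-inverse : {S : DiagonalMatrix n} {M N : Matrix n} → Exchanges S M N →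
                      denominator (H^ S) N ⊗ denominator (H^ S) M ≈ᴹ 1ᴹ
denominator-inverse {S = S} {M} {N} (exchanges MN) = ·-injective λ x i → begin
  ((denominator (H^ S) N ⊗ denominator (H^ S) M) · x) i
    ≡⟨ ⊗-· (denominator (H^ S) N) _ x i ⟩
  (denominator (H^ S) N · denominator (H^ S) M · x) i
    ≡⟨ ⟨,⟩-congˡ (denominator (H^ S) N i) (denominator-· S M x) ⟩
  (denominator (H^ S) N · exchange S x (M · x)) i
    ≡⟨ denominator-· S N _ i ⟩
  exchange S (exchange S x (M · x)) (N · exchange S x (M · x)) i
    ≡⟨ exchange-congʳ S (exchange S x (M · x)) (MN x) i ⟩
  exchange S (exchange S x (M · x)) (exchange S (M · x) x) i
    ≡⟨ exchange-involutive S x (M · x) i ⟩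
  x i
    ≡⟨ ⟨,⟩-1ᴹˡ i x ⟨
  (1ᴹ · x) i ∎

-- Once the denominator of `N` is known to invert that of `M`, the left side is the transform of `M`
-- under `H^ S`.
numerator-⊗-denominator : {S : DiagonalMatrix n} {M N : Matrix n} → Exchanges S N M →
                          numerator (H^ S) M ⊗ denominator (H^ S) N ≈ᴹ N
numerator-⊗-denominator {S = S} {M} {N} (exchanges NM) = ·-injective λ x i → begin
  ((numerator (H^ S) M ⊗ denominator (H^ S) N) · x) i
    ≡⟨ ⊗-· (numerator (H^ S) M) _ x i ⟩
  (numerator (H^ S) M · denominator (H^ S) N · x) i
    ≡⟨ ⟨,⟩-congˡ (numerator (H^ S) M i) (denominator-· S N x) ⟩
  (numerator (H^ S) M · exchange S x (N · x)) i
    ≡⟨ numerator-· S M _ i ⟩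
  exchange S (M · exchange S x (N · x)) (exchange S x (N · x)) i
    ≡⟨ exchange-congˡ S (exchange S x (N · x)) (NM x) i ⟩
  exchange S (exchange S (N · x) x) (exchange S x (N · x)) i
    ≡⟨ exchange-involutive S (N · x) x i ⟩
  (N · x) i ∎

-- Membership in ℋ is an equality of 2n × 2n matrices; the four parameters are read off the
-- diagonals of the quadrants.
blocks-injective : (Q R : 𝒞 n) → toMatrix Q ≈ᴹ toMatrix R →
  𝒞.A Q ≗ 𝒞.A R × 𝒞.B Q ≗ 𝒞.B R × 𝒞.C Q ≗ 𝒞.C R × 𝒞.D Q ≗ 𝒞.D R
blocks-injective {n} Q R Q≈R =
    (λ i → trans (sym (ul Q i)) (trans (Q≈R _ _) (ul R i)))
  , (λ i → trans (sym (ur Q i)) (trans (Q≈R _ _) (ur R i)))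
  , (λ i → trans (sym (ll Q i)) (trans (Q≈R _ _) (ll R i)))
  , (λ i → trans (sym (lr Q i)) (trans (Q≈R _ _) (lr R i)))
  where
  ul : ∀ Q i → toMatrix Q (i ↑ˡ n) (i ↑ˡ n) ≡ 𝒞.A Q i
  ul Q i rewrite splitAt-↑ˡ n i n | dec-true (i ≟ i) refl = refl

  ur : ∀ Q i → toMatrix Q (i ↑ˡ n) (n ↑ʳ i) ≡ 𝒞.B Q i
  ur Q i rewrite splitAt-↑ˡ n i n | splitAt-↑ʳ n n i | dec-true (i ≟ i) refl = refl

  ll : ∀ Q i → toMatrix Q (n ↑ʳ i) (i ↑ˡ n) ≡ 𝒞.C Q i
  ll Q i rewrite splitAt-↑ˡ n i n | splitAt-↑ʳ n n i | dec-true (i ≟ i) refl = refl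

  lr : ∀ Q i → toMatrix Q (n ↑ʳ i) (n ↑ʳ i) ≡ 𝒞.D Q i
  lr Q i rewrite splitAt-↑ʳ n n i | dec-true (i ≟ i) refl = refl

affine-cong : {a a′ b b′ : DiagonalMatrix n} (M : Matrix n) (x : Vector 𝔽₂ n) →
              a ≗ a′ → b ≗ b′ →
              (diag a ⊗ M ⊕ diag b) · x ≗ (diag a′ ⊗ M ⊕ diag b′) · x
affine-cong {a = a} {a′} {b} {b′} M x a≗a′ b≗b′ i =
  trans (affine-· a b M x i)
    (trans (cong₂ (λ s t → s * (M · x) i + t * x i) (a≗a′ i) (b≗b′ i))
      (sym (affine-· a′ b′ M x i)))

-- Applied to `denominator · x`, the transform gives `numerator · x`, and these two vectors are the
-- components of the exchanged pair.
transform⇒Exchanges : (Q : 𝒞 n) (S : DiagonalMatrix n) → toMatrix Q ≈ᴹ toMatrix (H^ S) →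
  {M N : Matrix n} (ns : Nonsingular (denominator Q M)) → transform Q M ns ≈ᴹ N →
  Exchanges S M N
transform⇒Exchanges Q S Q≈H {M} {N} ns@(inv , inv-den , _) T≈N .value x i
  with A≗ , B≗ , C≗ , D≗ ← blocks-injective Q (H^ S) Q≈H = begin
  (N · exchange S x (M · x)) i
    ≡⟨ ⟨,⟩-cong (λ k → sym (T≈N i k))
         (λ k → trans (sym (denominator-· S M x k)) (sym (affine-cong M x C≗ D≗ k))) ⟩
  ((numerator Q M ⊗ inv) · denominator Q M · x) i
    ≡⟨ ⊗-· (numerator Q M) inv _ i ⟩
  (numerator Q M · inv · denominator Q M · x) i
    ≡⟨ ⟨,⟩-congˡ (numerator Q M i) (λ k → trans (sym (⊗-· inv (denominator Q M) x k))
         (trans (⟨,⟩-cong {x = x} (inv-den k) (λ _ → refl)) (⟨,⟩-1ᴹˡ k x))) ⟩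
  (numerator Q M · x) i
    ≡⟨ affine-cong M x A≗ B≗ i ⟩
  (numerator (H^ S) M · x) i
    ≡⟨ numerator-· S M x i ⟩
  exchange S (M · x) x i ∎

-- Edge-local complementation as a rank-two update.

⋆-edge : (G : Graph n) (i u v : Fin n) → u ≢ v →
         edge (G ⋆ i) u v ≡ edge G u v + edge G i u * edge G i v
⋆-edge G i u v u≢v rewrite dec-false (u ≟ v) u≢v =
  bits (edge G i u ∧ edge G i v) (edge G u v)
  where
  bits : ∀ c e → (if c then not e else e) ≡ e + c
  bits true  true  = refl
  bits true  false = refl
  bits false true  = refl
  bits false false = refl

⋆-row : (G : Graph n) (i v : Fin n) → edge (G ⋆ i) i v ≡ edge G i v
⋆-row G i v rewrite irrefl G i = refl

-- The term `1ᴹ j v` keeps the diagonal entry zero: at `v = j` the added row `i` contributes 1.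
⋆-neighbour-row : (G : Graph n) {i j : Fin n} (v : Fin n) → edge G i j ≡ true →
                  edge (G ⋆ i) j v ≡ edge G j v + edge G i v + 1ᴹ j v
⋆-neighbour-row G {i} {j} v ij rewrite ij with j ≟ v
... | yes refl rewrite ij | irrefl G j = refl
... | no _     = bits (edge G i v) (edge G j v)
  where
  bits : ∀ a b → (if a then not b else b) ≡ b + a + 0#
  bits true  true  = refl
  bits true  false = refl
  bits false true  = refl
  bits false false = refl

edge⇒≢ : (G : Graph n) {i j : Fin n} → edge G i j ≡ true → i ≢ j
edge⇒≢ G {i} ij refl = contradiction (trans (sym ij) (irrefl G i)) λ ()

-- Row of Γ + I, the characteristic vector of the closed neighbourhood.
row : Graph n → Fin n → Vector 𝔽₂ n
row G i = edge G i +ⱽ 1ᴹ i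

ends : Pair n → DiagonalMatrix n
ends e = 1ᴹ (lo e) +ᴰ 1ᴹ (hi e)

-- Off the diagonal, each of the three local complementations adds the product of two entries of a
-- current row. With a the row of `i` in `G`, these rows are a, a + β and β + eᵢ; their three
-- products sum to αβᵀ + βαᵀ + eᵢeᵢᵀ.
⋆ᵉ-edge : (G : Graph n) (e : Pair n) → e IsEdgeOf G → ∀ u v →
          let α = row G (lo e); β = row G (hi e) in
          edge (G ⋆ᵉ e) u v ≡ edge G u v + (α u * β v + β u * α v)
⋆ᵉ-edge G e ij u v = by-cases (u ≟ v)
  where
  i  = lo e
  j  = hi e
  G₁ = G ⋆ i
  G₂ = G₁ ⋆ j
  g  = edge G u v
  a  = edge G i
  b  = edge G j

  row₁ : ∀ w → edge G₁ j w ≡ b w + a w + 1ᴹ j w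
  row₁ w = ⋆-neighbour-row G w ij

  ji₁ : edge G₁ j i ≡ true
  ji₁ = trans (symm G₁ j i) (trans (⋆-row G i j) ij)

  row₂ : ∀ w → edge G₂ i w ≡ a w + (b w + a w + 1ᴹ j w) + 1ᴹ i w
  row₂ w = trans (⋆-neighbour-row G₁ w ji₁)
    (cong (_+ 1ᴹ i w) (cong₂ _+_ (⋆-row G i w) (row₁ w)))

  -- The leftover eᵢeᵢᵀ lives on the diagonal only.
  disjoint : u ≢ v → 1ᴹ i u * 1ᴹ i v ≡ 0#
  disjoint u≢v with i ≟ u
  ... | yes refl = 1ᴹ-off-diagonal u≢v
  ... | no _     = refl

  by-cases : Dec (u ≡ v) →
    edge (G ⋆ᵉ e) u v ≡ g + (row G i u * row G j v + row G j u * row G i v)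
  by-cases (yes refl) = trans (irrefl (G ⋆ᵉ e) u) (sym (cong₂ _+_ (irrefl G u)
    (solve 2 (λ a b → a :* b :+ b :* a := con false) refl (row G i u) (row G j u))))
  by-cases (no u≢v) = begin
    edge (G ⋆ᵉ e) u v
      ≡⟨ ⋆-edge G₂ i u v u≢v ⟩
    edge G₂ u v + edge G₂ i u * edge G₂ i v
      ≡⟨ cong₂ _+_ (trans (⋆-edge G₁ j u v u≢v)
           (cong₂ _+_ (⋆-edge G i u v u≢v) (cong₂ _*_ (row₁ u) (row₁ v))))
           (cong₂ _*_ (row₂ u) (row₂ v)) ⟩
    g + a u * a v + (b u + a u + 1ᴹ j u) * (b v + a v + 1ᴹ j v)
      + (a u + (b u + a u + 1ᴹ j u) + 1ᴹ i u) * (a v + (b v + a v + 1ᴹ j v) + 1ᴹ i v)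
      ≡⟨ solve 9 (λ g au av bu bv iu iv ju jv →
            g :+ au :* av :+ (bu :+ au :+ ju) :* (bv :+ av :+ jv)
              :+ (au :+ (bu :+ au :+ ju) :+ iu) :* (av :+ (bv :+ av :+ jv) :+ iv)
            := (g :+ ((au :+ iu) :* (bv :+ jv) :+ (bu :+ ju) :* (av :+ iv)) :+ iu :* iv))
           refl g (a u) (a v) (b u) (b v) (1ᴹ i u) (1ᴹ i v) (1ᴹ j u) (1ᴹ j v) ⟩
    g + (row G i u * row G j v + row G j u * row G i v) + 1ᴹ i u * 1ᴹ i v
      ≡⟨ cong (g + (row G i u * row G j v + row G j u * row G i v) +_) (disjoint u≢v) ⟩
    g + (row G i u * row G j v + row G j u * row G i v) + 0#
      ≡⟨ +-identityʳ _ ⟩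
    g + (row G i u * row G j v + row G j u * row G i v) ∎

-- A pivot on an edge exchanges its two endpoints.

module _ (G : Graph n) (e : Pair n) (ij : e IsEdgeOf G) where
  private
    i = lo e
    j = hi e
    α = row G i
    β = row G j

    i≢j : i ≢ j
    i≢j = edge⇒≢ G ij

    αᵢ : α i ≡ 1#
    αᵢ rewrite irrefl G i | 1ᴹ-diagonal i = refl

    αⱼ : α j ≡ 1#
    αⱼ rewrite ij | 1ᴹ-off-diagonal i≢j = refl

    βᵢ : β i ≡ 1#
    βᵢ rewrite symm G j i | ij | 1ᴹ-off-diagonal (i≢j ∘ sym) = refl

    βⱼ : β j ≡ 1#
    βⱼ rewrite irrefl G j | 1ᴹ-diagonal j = refl

  -- Since α and β are both 1 at `i`, row `i` gains α + β, which turns α into β. The same happens at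
  -- `j` with the roles reversed.
  row-⋆ᵉ-lo : row (G ⋆ᵉ e) i ≗ β
  row-⋆ᵉ-lo v rewrite ⋆ᵉ-edge G e ij i v | αᵢ | βᵢ =
    solve 3 (λ a b i → a :+ (b :+ (a :+ i)) :+ i := b) refl (edge G i v) (β v) (1ᴹ i v)

  row-⋆ᵉ-hi : row (G ⋆ᵉ e) j ≗ α
  row-⋆ᵉ-hi v rewrite ⋆ᵉ-edge G e ij j v | αⱼ | βⱼ =
    solve 3 (λ a b j → b :+ ((b :+ j) :+ a) :+ j := a) refl (α v) (edge G j v) (1ᴹ j v)

  ⋆ᵉ-preserves-edge : e IsEdgeOf (G ⋆ᵉ e)
  ⋆ᵉ-preserves-edge = trans (⋆ᵉ-edge G e ij i j)
    (cong₂ _+_ ij (cong₂ _+_ (cong₂ _*_ αᵢ βⱼ) (cong₂ _*_ βᵢ αⱼ)))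

  -- Here x′ = x + s eᵢ + t eⱼ with s = ⟨α, x⟩ and t = ⟨β, x⟩. As α and β are 1 at both ends, ⟨α,
  -- x′⟩ = t and ⟨β, x′⟩ = s. In the new value, s α and t β cancel rows `i` and `j` of Γ up to unit
  -- vectors, leaving y + s eᵢ + t eⱼ.
  ⋆ᵉ-exchanges : Exchanges (ends e) (adjacencyMatrix G) (adjacencyMatrix (G ⋆ᵉ e))
  ⋆ᵉ-exchanges .value x u = begin
    ⟨ edge (G ⋆ᵉ e) u , x′ ⟩
      ≡⟨ ⟨,⟩-cong {x = x′} (⋆ᵉ-edge G e ij u) (λ _ → refl) ⟩
    ⟨ edge G u +ⱽ (α u *ⱽ β +ⱽ β u *ⱽ α) , x′ ⟩
      ≡⟨ ⟨,⟩-+ˡ (edge G u) (α u *ⱽ β +ⱽ β u *ⱽ α) x′ ⟩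
    ⟨ edge G u , x′ ⟩ + ⟨ α u *ⱽ β +ⱽ β u *ⱽ α , x′ ⟩
      ≡⟨ cong (⟨ edge G u , x′ ⟩ +_) (trans (⟨,⟩-+ˡ (α u *ⱽ β) (β u *ⱽ α) x′)
           (cong₂ _+_ (⟨,⟩-*ˡ (α u) β x′) (⟨,⟩-*ˡ (β u) α x′))) ⟩
    ⟨ edge G u , x′ ⟩ + (α u * ⟨ β , x′ ⟩ + β u * ⟨ α , x′ ⟩)
      ≡⟨ cong₂ _+_ (⟨,x′⟩ (edge G u)) (cong₂ (λ p q → α u * p + β u * q) ⟨β,x′⟩ ⟨α,x′⟩) ⟩
    y u + (s * edge G u i + t * edge G u j) + (α u * s + β u * t)
      ≡⟨ cong₂ (λ p q → y u + (s * p + t * q) + (α u * s + β u * t)) (symm G u i) (symm G u j) ⟩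
    y u + (s * edge G i u + t * edge G j u) + (α u * s + β u * t)
      ≡⟨ solve 7 (λ y s t a b i j → y :+ (s :* a :+ t :* b) :+ ((a :+ i) :* s :+ (b :+ j) :* t)
                                      := (y :+ (i :* s :+ j :* t)))
           refl (y u) s t (edge G i u) (edge G j u) (1ᴹ i u) (1ᴹ j u) ⟩
    y u + (1ᴹ i u * s + 1ᴹ j u * t)
      ≡⟨ cong (y u +_) (cong₂ (λ p q → 1ᴹ i u * p + 1ᴹ j u * q) (+-comm (y i) (x i)) (+-comm (y j) (x j))) ⟩
    y u + (1ᴹ i u * (x i + y i) + 1ᴹ j u * (x j + y j))
      ≡⟨ exchange-ends y x u ⟨
    exchange (ends e) y x u ∎
    where
    y  = adjacencyMatrix G · x
    x′ = exchange (ends e) x y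
    s  = y i + x i
    t  = y j + x j

    -- In characteristic 2, swapping `x k` with `y k` adds `y k + x k` to each.
    exchange-ends : ∀ x y k →
      exchange (ends e) x y k ≡ x k + (1ᴹ i k * (y i + x i) + 1ᴹ j k * (y j + x j))
    exchange-ends x y k with i ≟ k | j ≟ k
    ... | yes refl | yes refl = contradiction refl i≢j
    ... | yes refl | no _     = solve 2 (λ x y → y :+ con false := (x :+ (y :+ x :+ con false))) refl (x k) (y k)
    ... | no _     | yes refl = solve 2 (λ x y → y :+ con false := (x :+ (y :+ x))) refl (x k) (y k)
    ... | no _     | no _     = sym (+-identityʳ (x k))

    ⟨,x′⟩ : ∀ a → ⟨ a , x′ ⟩ ≡ ⟨ a , x ⟩ + (s * a i + t * a j)
    ⟨,x′⟩ a = begin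
      ⟨ a , x′ ⟩
        ≡⟨ ⟨,⟩-comm a x′ ⟩
      ⟨ x′ , a ⟩
        ≡⟨ ⟨,⟩-cong {y = a} (λ k → trans (exchange-ends x y k)
             (cong (x k +_) (cong₂ _+_ (*-comm (1ᴹ i k) s) (*-comm (1ᴹ j k) t)))) (λ _ → refl) ⟩
      ⟨ x +ⱽ (s *ⱽ 1ᴹ i +ⱽ t *ⱽ 1ᴹ j) , a ⟩
        ≡⟨ ⟨,⟩-+ˡ x (s *ⱽ 1ᴹ i +ⱽ t *ⱽ 1ᴹ j) a ⟩
      ⟨ x , a ⟩ + ⟨ s *ⱽ 1ᴹ i +ⱽ t *ⱽ 1ᴹ j , a ⟩
        ≡⟨ cong₂ _+_ (⟨,⟩-comm x a) (trans (⟨,⟩-+ˡ (s *ⱽ 1ᴹ i) (t *ⱽ 1ᴹ j) a)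
             (cong₂ _+_ (scaled s i) (scaled t j))) ⟩
      ⟨ a , x ⟩ + (s * a i + t * a j) ∎
      where
      scaled : ∀ r k → ⟨ r *ⱽ 1ᴹ k , a ⟩ ≡ r * a k
      scaled r k = trans (⟨,⟩-*ˡ r (1ᴹ k) a) (cong (r *_) (⟨,⟩-1ᴹˡ k a))

    ⟨row,x⟩ : ∀ k → ⟨ row G k , x ⟩ ≡ y k + x k
    ⟨row,x⟩ k = trans (⟨,⟩-+ˡ (edge G k) (1ᴹ k) x) (cong (y k +_) (⟨,⟩-1ᴹˡ k x))

    ⟨α,x′⟩ : ⟨ α , x′ ⟩ ≡ t
    ⟨α,x′⟩ rewrite ⟨,x′⟩ α | ⟨row,x⟩ i | αᵢ | αⱼ =
      solve 2 (λ s t → s :+ (s :* con true :+ t :* con true) := t) refl s t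

    ⟨β,x′⟩ : ⟨ β , x′ ⟩ ≡ s
    ⟨β,x′⟩ rewrite ⟨,x′⟩ β | ⟨row,x⟩ j | βᵢ | βⱼ =
      solve 2 (λ s t → t :+ (s :* con true :+ t :* con true) := s) refl s t

-- The first pivot interchanges α and β, and αβᵀ + βαᵀ is symmetric in them, so the second adds the
-- same update again.
⋆ᵉ-involutive : (G : Graph n) (e : Pair n) → e IsEdgeOf G → G ⋆ᵉ e ⋆ᵉ e ≈ᴳ G
⋆ᵉ-involutive G e ij u v
  rewrite ⋆ᵉ-edge (G ⋆ᵉ e) e (⋆ᵉ-preserves-edge G e ij) u v
        | row-⋆ᵉ-lo G e ij u | row-⋆ᵉ-lo G e ij v
        | row-⋆ᵉ-hi G e ij u | row-⋆ᵉ-hi G e ij v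
        | ⋆ᵉ-edge G e ij u v =
  solve 5 (λ g au av bu bv → g :+ (au :* bv :+ bu :* av) :+ (bu :* av :+ au :* bv) := g)
    refl (edge G u v) (row G (lo e) u) (row G (lo e) v) (row G (hi e) u) (row G (hi e) v)

⋆ᵉ-exchanges⁻¹ : (G : Graph n) (e : Pair n) → e IsEdgeOf G →
                 Exchanges (ends e) (adjacencyMatrix (G ⋆ᵉ e)) (adjacencyMatrix G)
⋆ᵉ-exchanges⁻¹ G e ij =
  Exchanges-reindex (λ k → +-identityʳ (ends e k))
    (Exchanges-trans (⋆ᵉ-exchanges (G ⋆ᵉ e) e (⋆ᵉ-preserves-edge G e ij))
                     (Exchanges-0 (⋆ᵉ-involutive G e ij)))

-- Sequences of pivots versus exchanges.

-- The exchange is kept in both directions because the two together make the denominator of `G′` a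
-- two-sided inverse of that of `G`.
ELE⇒Exchanges : (G G′ : Graph n) → EdgeLocallyEquivalent G G′ →
  ∃[ S ] (Exchanges S (adjacencyMatrix G) (adjacencyMatrix G′)
        × Exchanges S (adjacencyMatrix G′) (adjacencyMatrix G))
ELE⇒Exchanges G G′ ([] , _ , G≈G′) =
  (λ _ → 0#) , Exchanges-0 G≈G′ , Exchanges-0 (λ i j → sym (G≈G′ i j))
ELE⇒Exchanges G G′ (e ∷ es , (ij , adm) , eq)
  with S , to , from ← ELE⇒Exchanges (G ⋆ᵉ e) G′ (es , adm , eq) =
    ends e +ᴰ S
  , Exchanges-trans (⋆ᵉ-exchanges G e ij) to
  , Exchanges-reindex (λ k → +-comm (S k) (ends e k))
      (Exchanges-trans from (⋆ᵉ-exchanges⁻¹ G e ij))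

neighbour-in-support : (G G′ : Graph n) {S : DiagonalMatrix n} →
  Exchanges S (adjacencyMatrix G) (adjacencyMatrix G′) →
  ∀ i → S i ≡ true → ∃[ j ] (edge G i j ≡ true × S j ≡ true)
neighbour-in-support G G′ {S} ex i Sᵢ
  with any? (λ j → edge G i j ∧ S j ≟ᵇ true)
... | yes (j , p) = j , ∧-true (edge G i j) (S j) p
  where
  ∧-true : ∀ b c → b ∧ c ≡ true → b ≡ true × c ≡ true
  ∧-true true true _ = refl , refl
... | no isolated = contradiction (trans (sym value-one) (trans (sym (ex .value x i)) value-zero)) λ ()
  where
  x = 1ᴹ i
  y = adjacencyMatrix G · x

  yₖ : ∀ k → y k ≡ edge G i k
  yₖ k = trans (⟨,⟩-comm (edge G k) x) (trans (⟨,⟩-1ᴹˡ i (edge G k)) (symm G k i))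

  bits : ∀ b c → b ∧ c ≢ true → c * b ≡ 0#
  bits true  true  p = contradiction refl p
  bits true  false p = refl
  bits false true  p = refl
  bits false false p = refl

  vanishes : ∀ k → exchange S x y k ≡ 0#
  vanishes k rewrite yₖ k | bits (edge G i k) (S k) (λ p → isolated (k , p)) with i ≟ k
  -- At `k = i` the entry 1 of `x` is lost, because `i` lies in `S`.
  ... | yes refl rewrite Sᵢ = refl
  ... | no _ = zeroʳ (S k + 1#)

  value-zero : (adjacencyMatrix G′ · exchange S x y) i ≡ 0#
  value-zero = ⟨,⟩-zeroʳ (edge G′ i) vanishes

  value-one : exchange S y x i ≡ 1#
  value-one rewrite Sᵢ | 1ᴹ-diagonal i = refl

-- A `Pair` is ordered, while the pivot found in the support is not; `ends` is symmetric in the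
-- endpoints.
pair : (G : Graph n) {i j : Fin n} → edge G i j ≡ true →
       ∃[ e ] (e IsEdgeOf G × ends e ≗ 1ᴹ i +ᴰ 1ᴹ j)
pair G {i} {j} ij with <-cmp i j
... | tri< i<j _ _ = record { lo<hi = i<j } , ij , λ _ → refl
... | tri≈ _ i≡j _ = contradiction i≡j (edge⇒≢ G ij)
... | tri> _ _ j<i = record { lo<hi = j<i } , trans (symm G j i) ij , λ k → +-comm (1ᴹ j k) (1ᴹ i k)

-- Both `v` and `w` lie in `S`, so adding their unit vectors removes them from the support and
-- creates no new element.
pivoted-support : (S : DiagonalMatrix n) {v w : Fin n} → v ≢ w → S v ≡ true → S w ≡ true →
                  ∀ k → (1ᴹ v +ᴰ 1ᴹ w +ᴰ S) k ≡ true → k ≢ v × S k ≡ true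
pivoted-support S {v} {w} v≢w Sᵥ S_w k p with v ≟ k | w ≟ k
... | yes refl | yes refl = contradiction refl v≢w
... | yes refl | no _     rewrite Sᵥ  = contradiction p λ ()
... | no _     | yes refl rewrite S_w = contradiction p λ ()
... | no v≢k   | no _     = v≢k ∘ sym , p

-- Bounding the support of S by a list makes the recursion structural.
Exchanges⇒ELE : (vs : List (Fin n)) (G G′ : Graph n) (S : DiagonalMatrix n) →
  (∀ k → S k ≡ true → k ∈ vs) →
  Exchanges S (adjacencyMatrix G) (adjacencyMatrix G′) →
  EdgeLocallyEquivalent G G′
Exchanges⇒ELE [] G G′ S supp ex =
  [] , _ , Exchanges-0⁻¹ (Exchanges-reindex empty ex)
  where
  empty : ∀ k → S k ≡ 0#
  empty k with S k in Sₖ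
  ... | false = refl
  ... | true  with () ← supp k Sₖ
Exchanges⇒ELE (v ∷ vs) G G′ S supp ex with S v in Sᵥ
... | false = Exchanges⇒ELE vs G G′ S
  (λ k Sₖ → tail (λ { refl → contradiction (trans (sym Sₖ) Sᵥ) λ () }) (supp k Sₖ)) ex
... | true
  with w , vw , S_w ← neighbour-in-support G G′ ex v Sᵥ
  with e , isEdge , ends≗ ← pair G vw
  with es , adm , eq ← Exchanges⇒ELE vs (G ⋆ᵉ e) G′ (ends e +ᴰ S) 
                         (λ k p → let k≢v , Sₖ = pivoted-support S (edge⇒≢ G vw) Sᵥ S_w k
                                                   (trans (cong (_+ S k) (sym (ends≗ k))) p)
                                  in tail k≢v (supp k Sₖ))
                         -- Undoing the pivot and then exchanging on `S` relates `G ⋆ᵉ e` to `G′`,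
                         -- on a support that avoids `v`.
                         (Exchanges-trans (⋆ᵉ-exchanges⁻¹ G e isEdge) ex)
  = e ∷ es , (isEdge , adm) , eq

theorem2 : ∀ (n : ℕ) (G G′ : Graph n) →
    EdgeLocallyEquivalent G G′
    ⇔ (Σ[ H ∈ 𝒞 n ] (H ∈ℋ × Σ[ Γ∈Δ ∈ adjacencyMatrix G ∈Δ H ] image H Γ∈Δ ≈ᴹ adjacencyMatrix G′))
theorem2 n G G′ = mk⇔ to from
  where
  Γ  = adjacencyMatrix G
  Γ′ = adjacencyMatrix G′

  to : EdgeLocallyEquivalent G G′ →
       Σ[ H ∈ 𝒞 n ] (H ∈ℋ × Σ[ Γ∈Δ ∈ Γ ∈Δ H ] image H Γ∈Δ ≈ᴹ Γ′)
  to G∼G′ with S , ΓΓ′ , Γ′Γ ← ELE⇒Exchanges G G′ G∼G′ =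
    H^ S , (S , λ _ _ → refl) , Γ∈Δ , numerator-⊗-denominator Γ′Γ
    where
    Γ∈Δ : Γ ∈Δ H^ S
    Γ∈Δ = record
      { isAdjacencyMatrix = record { symmetric = symm G ; zeroDiagonal = irrefl G }
      -- The inverse is the denominator of the target Γ′; the transform is then Γ′, whence its zero
      -- diagonal.
      ; nonsingular = denominator (H^ S) Γ′ , denominator-inverse ΓΓ′ , denominator-inverse Γ′Γ
      ; zeroDiagonal = λ i → trans (numerator-⊗-denominator Γ′Γ i i) (irrefl G′ i)
      }

  from : Σ[ H ∈ 𝒞 n ] (H ∈ℋ × Σ[ Γ∈Δ ∈ Γ ∈Δ H ] image H Γ∈Δ ≈ᴹ Γ′) →
         EdgeLocallyEquivalent G G′
  from (H , (S , H≈) , Γ∈Δ , eq) =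
    Exchanges⇒ELE (allFin n) G G′ S (λ k _ → ∈-allFin k)
      (transform⇒Exchanges H S H≈ (_∈Δ_.nonsingular Γ∈Δ) eq)
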